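{- Let $\Gamma$ be a free numerical semigroup with respect to the arrangement $(n_1,\ldots,n_e)$ of its minimal generators, and let $c_i=d_i/d_{i+1}$ with $d_i=\gcd(n_1,\dots,n_{i-1})$ for $i\in\{2,\dots,e\}$ and $d_{e+1}=\gcd(n_1,\dots,n_e)=1$. If $\frac{c_i-1}{c_i}\, n_i\ge n_1$ for all $i\in\{3,\ldots,e\}$, then $\mathrm E(\Gamma,2)=\mathrm m(\Gamma)$.
   Context: $\mathbb N$ denotes the non-negative integers. A numerical semigroup is a set $\langle n_1,\dots,n_m\rangle:=n_1\mathbb N+\cdots+n_m\mathbb N$ with $n_i$ positive integers and $\gcd(n_1,\dots,n_m)=1$. The minimal generators of $\Gamma$ are the elements of its unique minimal generating set. The multiplicity $\mathrm m(\Gamma)$ is the smallest positive element of $\Gamma$. For $x\in\mathbb Z$, the Apéry set is $\operatorname{Ap}(\Gamma,x)=\{a\in\Gamma\mid a-x\notin\Gamma\}$. Free: given an arrangement (ordering) $(n_1,\dots,n_e)$ of the minimal generators of $\Gamma$, put $d_i:=\gcd(n_1,\ldots,n_{i-1})$ and $c_i:=d_i/d_{i+1}$. The semigroup $\Gamma$ is free with respect to the arrangement $(n_1,\dots,n_e)$ (not necessarily increasing) if $d_i>d_{i+1}$ and $c_in_i\in\langle n_1,\ldots,n_{i-1}\rangle$ for all $i\in\{2,\ldots,e\}$. ($\mathbb N$ itself, with $e=1$, counts as free.) Second Feng-Rao number: for $b\in\Gamma$ let $\mathrm D(b)=\{c\in\Gamma\mid b-c\in\Gamma\}$, and let $\delta^2_{FR}(a)=\min\{\#(\mathrm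 D(b_1)\cup \mathrm D(b_2))\mid b_1,b_2\in\Gamma,\ a\le b_1<b_2\}$. With $c$ the conductor of $\Gamma$ (least integer $c\ge0$ such that all integers $\ge c$ lie in $\Gamma$) and $g=\#(\mathbb N\setminus\Gamma)$ the genus, $\mathrm E(\Gamma,2)$ is the constant such that $\delta^2_{FR}(a)=a+1-2g+\mathrm E(\Gamma,2)$ for all non-negative integers $a\ge 2c-1$. It is known (and may be taken as the definition) that $\mathrm E(\Gamma,2)=\min\{\#\operatorname{Ap}(\Gamma,x)\mid x\in\mathbb N\setminus\{0\}\}$. -}

module Defs where

open import Data.Fin.Base using (Fin; toℕ)
open import Data.Integer.Base as ℤ using (ℤ; +_)
open import Data.List.Base using (List; []; _∷_; foldr; length; lookup; take)
open import Data.List.Membership.Propositional using () renaming (_∈_ to _∈ˡ_)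
open import Data.List.Relation.Binary.Subset.Propositional using () renaming (_⊆_ to _⊆ˡ_)
open import Data.List.Relation.Unary.All using (All; []; _∷_)
open import Data.List.Relation.Unary.Unique.Propositional using (Unique)
open import Data.Nat.Base
open import Data.Nat.GCD using (gcd; gcd[m,n]≢0)
open import Data.Product.Base using (_×_; ∃-syntax)
open import Data.Sum.Base using (inj₁)
open import Function.Bundles using (_⇔_)
open import Level using (0ℓ)
open import Relation.Binary.PropositionalEquality using (_≡_)
open import Relation.Nullary.Negation using (¬_)
open import Relation.Unary using (Pred; _∈_; _≐_)

gcds : List ℕ → ℕ
gcds = foldr gcd 0

-- n₁ℕ + ⋯ + nₘℕ
⟨_⟩ : List ℕ → Pred ℕ 0ℓ
⟨ [] ⟩     x = x ≡ 0
⟨ n ∷ ns ⟩ x = ∃[ k ] ∃[ y ] y ∈ ⟨ ns ⟩ × x ≡ k * n + y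

record IsNumericalSemigroup (Γ : Pred ℕ 0ℓ) : Set where
  field
    generators : List ℕ
    positive   : All NonZero generators
    coprime    : gcds generators ≡ 1
    generates  : Γ ≐ ⟨ generators ⟩

-- `ns` lists, without repetition, an inclusion-minimal generating set of Γ.
record IsArrangementOfMinimalGenerators (Γ : Pred ℕ 0ℓ) (ns : List ℕ) : Set where
  field
    positive  : All NonZero ns
    unique    : Unique ns
    generates : Γ ≐ ⟨ ns ⟩
    minimal   : ∀ ms → ms ⊆ˡ ns → Γ ≐ ⟨ ms ⟩ → ns ⊆ˡ ms

-- Positions are counted from 0: i : Fin (length ns) stands for the classical
-- index toℕ i + 1.  Hence d ns k is the classical d_{k+1} = gcd (n₁, …, n_k), and
-- for an entry at position i the classical pair d_i, d_{i+1} is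
-- d ns (toℕ i), d ns (suc (toℕ i)).
d : List ℕ → ℕ → ℕ
d ns k = gcds (take k ns)

d-nonZero : ∀ {ns} → All NonZero ns → (i : Fin (length ns)) → NonZero (d ns (suc (toℕ i)))
d-nonZero {n ∷ ns} (n≢0 ∷ _) i =
  ≢-nonZero (gcd[m,n]≢0 n (gcds (take (toℕ i) ns)) (inj₁ (≢-nonZero⁻¹ n {{n≢0}})))

c : (ns : List ℕ) → All NonZero ns → Fin (length ns) → ℕ
c ns pos i = _/_ (d ns (toℕ i)) (d ns (suc (toℕ i))) {{d-nonZero pos i}}

record IsFree (Γ : Pred ℕ 0ℓ) (ns : List ℕ) : Set where
  field
    arrangement : IsArrangementOfMinimalGenerators Γ ns

  open IsArrangementOfMinimalGenerators arrangement public

  field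
    d-decreasing : ∀ (i : Fin (length ns)) → 1 ≤ toℕ i → d ns (toℕ i) > d ns (suc (toℕ i))
    c*n∈prefix   : ∀ i → 1 ≤ toℕ i →
                   c ns positive i * lookup ns i ∈ ⟨ take (toℕ i) ns ⟩

IsMinimum : Pred ℕ 0ℓ → Pred ℕ 0ℓ
IsMinimum P k = k ∈ P × (∀ j → j ∈ P → k ≤ j)

IsMultiplicity : Pred ℕ 0ℓ → Pred ℕ 0ℓ
IsMultiplicity Γ = IsMinimum (λ x → 0 < x × x ∈ Γ)

HasCardinality : Pred ℕ 0ℓ → Pred ℕ 0ℓ
HasCardinality P k =
  ∃[ xs ] Unique xs × (∀ x → (x ∈ˡ xs) ⇔ (x ∈ P)) × length xs ≡ k

-- The difference a − x is taken in ℤ; it lies in Γ iff it is + b for some b ∈ Γ.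
Ap : Pred ℕ 0ℓ → ℤ → Pred ℕ 0ℓ
Ap Γ x a = a ∈ Γ × ¬ (∃[ b ] b ∈ Γ × + a ℤ.- x ≡ + b)

-- k = E(Γ,2), the second Feng–Rao number, taken in the form
-- E(Γ,2) = min { #Ap(Γ,x) | x ∈ ℕ ∖ {0} }.
IsE₂ : Pred ℕ 0ℓ → Pred ℕ 0ℓ
IsE₂ Γ = IsMinimum (λ k → ∃[ x ] 0 < x × HasCardinality (Ap Γ (+ x)) k)

{-# OPTIONS --safe #-}

-- Write Gᵢ = ⟨n₁, …, nᵢ⟩ and Dᵢ = gcd (n₁, …, nᵢ), and let M be the multiplicity of Γ.
-- By induction on i, Dᵢ · #Ap(Gᵢ, x) ≥ M for every positive multiple x of Dᵢ.
-- Every element of Gᵢ₊₁ is s + n j for a unique pair s ∈ Gᵢ, 0 ≤ j < c, where n = nᵢ₊₁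
-- and c = Dᵢ / Dᵢ₊₁.  If w = x + n r is the multiple of Dᵢ with 0 ≤ r < c, then s + n j
-- lies in Ap(Gᵢ₊₁, x) for all s ∈ Ap(Gᵢ, w) and j < c − r, so that
-- #Ap(Gᵢ₊₁, x) ≥ (c − r) · #Ap(Gᵢ, w).  For r = 0 the induction hypothesis finishes the
-- step.  For r > 0 the least elements of Gᵢ in the classes modulo w give
-- #Ap(Gᵢ, w) ≥ w / Dᵢ, and Dᵢ₊₁ (c − r) w / Dᵢ > r (c − r) n / c ≥ (c − 1) n / c.
-- For i ≥ 2 the right-hand side is at least n₁ ≥ M by hypothesis.  For i = 1 the left-hand
-- side is a multiple of D₂, so that exceeding (c − 1) n₂ / c with c = n₁ / D₂ forces it to
-- be at least min (n₁, n₂) ≥ M.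
module Submission where

open import Defs
open import Data.Empty using (⊥-elim)
open import Data.Fin.Base using (Fin; zero; suc; toℕ; fromℕ; fromℕ<; inject₁; remQuot; combine)
open import Data.Fin.Induction using (<-weakInduction)
open import Data.Fin.Properties
  using (toℕ<n; toℕ-injective; toℕ-fromℕ; toℕ-fromℕ<; toℕ-inject₁; combine-remQuot; injective⇒≤)
open import Data.Integer.Base as ℤ using (+_)
import Data.Integer.Properties as ℤ
open import Data.List.Base using (List; []; _∷_; _∷ʳ_; length; lookup; take; tabulate)
open import Data.List.Membership.Propositional using () renaming (_∈_ to _∈ˡ_)
open import Data.List.Membership.Propositional.Properties using (∈-lookup; ∈-tabulate⁺; ∈-tabulate⁻)
open import Data.List.Membership.Setoid.Properties using (index-injective)
open import Data.List.Properties using (length-tabulate; take-suc; take-all)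
open import Data.List.Relation.Unary.All as All using (All; []; _∷_)
import Data.List.Relation.Unary.All.Properties as All
open import Data.List.Relation.Unary.Any using (index)
open import Data.List.Relation.Unary.Unique.Propositional.Properties using (tabulate⁺)
open import Data.Nat.Base
open import Data.Nat.Coprimality using (Coprime; coprime-divisor; coprime-Bézout; gcd≡1⇒coprime)
open import Data.Nat.Divisibility
open import Data.Nat.DivMod
open import Data.Nat.GCD
open import Data.Nat.Induction using (<-rec)
open import Data.Nat.Properties
open import Data.Nat.Tactic.RingSolver using (solve-∀)
open import Data.Product.Base using (_×_; _,_; proj₁; proj₂; ∃; ∃-syntax; map₂; uncurry)
open import Data.Sum.Base using (_⊎_; inj₁; inj₂)
open import Function.Base using (_∘_)
open import Function.Bundles using (mk⇔; module Equivalence)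
open import Function.Definitions using (Injective)
open import Level using (0ℓ)
open import Relation.Binary.PropositionalEquality
open import Relation.Nullary.Decidable.Core using (yes; no; map′; _×-dec_)
open import Relation.Unary using (Pred; _∈_; _≐_; Decidable)
open import Relation.Unary.Properties using (≐-sym; ≐-trans)

private variable
  P : Pred ℕ 0ℓ
  ns : List ℕ

-- Minima and cardinalities

minimum : Decidable P → ∀ {n} → n ∈ P → ∃ (IsMinimum P)
minimum {P} P? {n} = <-rec (λ n → n ∈ P → ∃ (IsMinimum P)) step n
  where
  step : ∀ n → (∀ {m} → m < n → m ∈ P → ∃ (IsMinimum P)) → n ∈ P → ∃ (IsMinimum P)
  step n rec n∈P with anyUpTo? P? n
  ... | yes (m , m<n , m∈P) = rec m<n m∈P
  ... | no none = n , n∈P , λ j j∈P → ≮⇒≥ (λ j<n → none (j , j<n , j∈P))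

-- An injection from `Fin k` bounds the cardinality from below without deciding `P` or listing its
-- elements.
AtLeast : ℕ → Pred ℕ 0ℓ → Set
AtLeast k P = ∃[ f ] Injective {A = Fin k} _≡_ _≡_ f × (∀ i → f i ∈ P)

atLeast⇒≤ : ∀ {k l} → AtLeast k P → HasCardinality P l → k ≤ l
atLeast⇒≤ {k = k} (f , f-inj , f∈P) (xs , _ , xs⇔P , refl) =
  injective⇒≤ {f = index ∘ f∈xs} λ {i} {j} → f-inj ∘ index-injective (setoid ℕ) (f∈xs i) (f∈xs j)
  where f∈xs = λ i → Equivalence.from (xs⇔P (f i)) (f∈P i)

hasCardinality-resp-≐ : ∀ {Q k} → P ≐ Q → HasCardinality P k → HasCardinality Q k
hasCardinality-resp-≐ (P⊆Q , Q⊆P) (xs , xs! , xs⇔P , len) =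
  xs , xs! , (λ x → mk⇔ (P⊆Q ∘ Equivalence.to (xs⇔P x)) (Equivalence.from (xs⇔P x) ∘ Q⊆P)) , len

surjective⇒hasCardinality : ∀ {k} ((f , _) : AtLeast k P) → (∀ {a} → a ∈ P → ∃[ i ] a ≡ f i) →
                            HasCardinality P k
surjective⇒hasCardinality {P} (f , f-inj , f∈P) f-surj =
  tabulate f , tabulate⁺ f-inj , (λ x → mk⇔ (to x) (from x)) , length-tabulate f
  where
  to = λ x x∈ → let i , x≡fi = ∈-tabulate⁻ {f = f} x∈ in subst P (sym x≡fi) (f∈P i)
  from = λ x x∈P → let i , x≡fi = f-surj x∈P in subst (_∈ˡ tabulate f) (sym x≡fi) (∈-tabulate⁺ i)

atLeast-× : ∀ {Q : Pred ℕ 0ℓ} {j q} → AtLeast q P → (F : ℕ → ℕ → ℕ) →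
            (∀ {a b i k} → a ∈ P → b ∈ P → i < j → k < j → F a i ≡ F b k → a ≡ b × i ≡ k) →
            (∀ {a i} → a ∈ P → i < j → F a i ∈ Q) → AtLeast (j * q) Q
atLeast-× {j = j} {q} (f , f-inj , f∈P) F F-inj F∈Q =
  G ∘ remQuot q , inj , λ i → F∈Q (f∈P _) (toℕ<n _)
  where
  G : Fin j × Fin q → ℕ
  G (i , k) = F (f k) (toℕ i)
  G-inj : ∀ {u v} → G u ≡ G v → u ≡ v
  G-inj eq = let fk≡ , i≡ = F-inj (f∈P _) (f∈P _) (toℕ<n _) (toℕ<n _) eq
             in cong₂ _,_ (toℕ-injective i≡) (f-inj fk≡)
  inj : Injective _≡_ _≡_ (G ∘ remQuot q)
  inj {u} {v} eq = begin
    u                                 ≡⟨ combine-remQuot {j} q u ⟨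
    uncurry combine (remQuot {j} q u) ≡⟨ cong (uncurry combine) (G-inj {remQuot q u} {remQuot q v} eq) ⟩
    uncurry combine (remQuot {j} q v) ≡⟨ combine-remQuot {j} q v ⟩
    v                                 ∎
    where open ≡-Reasoning

-- Apéry sets

-- Together with `Ap⁻`, trades the integer difference for an equation in ℕ.
Ap⁺ : ∀ {x a} → a ∈ P → (∀ {b} → b ∈ P → a ≢ b + x) → a ∈ Ap P (+ x)
Ap⁺ {x = x} {a} a∈P a≢ = a∈P , λ (b , b∈P , a-x≡b) → a≢ b∈P (ℤ.+-injective (begin
  + a                        ≡⟨ ℤ.+-identityʳ (+ a) ⟨
  + a ℤ.+ + 0                ≡⟨ cong (ℤ._+_ (+ a)) (ℤ.+-inverseˡ (+ x)) ⟨
  + a ℤ.+ (ℤ.- + x ℤ.+ + x)  ≡⟨ ℤ.+-assoc (+ a) (ℤ.- + x) (+ x) ⟨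
  + a ℤ.- + x ℤ.+ + x        ≡⟨ cong (ℤ._+ + x) a-x≡b ⟩
  + b ℤ.+ + x                ≡⟨ ℤ.pos-+ b x ⟨
  + (b + x)                  ∎))
  where open ≡-Reasoning

Ap⁻ : ∀ {x a b} → a ∈ Ap P (+ x) → b ∈ P → a ≢ b + x
Ap⁻ {x = x} {b = b} (_ , a-x∉P) b∈P refl = a-x∉P (b , b∈P , (begin
  + (b + x) ℤ.- + x            ≡⟨ cong (ℤ._- + x) (ℤ.pos-+ b x) ⟩
  + b ℤ.+ + x ℤ.- + x          ≡⟨ ℤ.+-assoc (+ b) (+ x) (ℤ.- + x) ⟩
  + b ℤ.+ (+ x ℤ.- + x)        ≡⟨ cong (ℤ._+_ (+ b)) (ℤ.+-inverseʳ (+ x)) ⟩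
  + b ℤ.+ + 0                  ≡⟨ ℤ.+-identityʳ (+ b) ⟩
  + b                          ∎))
  where open ≡-Reasoning

Ap-resp-≐ : ∀ {Q} x → P ≐ Q → Ap P x ≐ Ap Q x
Ap-resp-≐ x (P⊆Q , Q⊆P) =
  (λ (a∈P , a-x∉P) → P⊆Q a∈P , λ (b , b∈Q , eq) → a-x∉P (b , Q⊆P b∈Q , eq)) ,
  (λ (a∈Q , a-x∉Q) → Q⊆P a∈Q , λ (b , b∈P , eq) → a-x∉Q (b , P⊆Q b∈P , eq))

-- Generated submonoids of ℕ

0∈⟨_⟩ : ∀ ns → 0 ∈ ⟨ ns ⟩
0∈⟨ [] ⟩     = refl
0∈⟨ n ∷ ns ⟩ = 0 , 0 , 0∈⟨ ns ⟩ , refl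

⟨⟩-+ : ∀ ns {x y} → x ∈ ⟨ ns ⟩ → y ∈ ⟨ ns ⟩ → x + y ∈ ⟨ ns ⟩
⟨⟩-+ []       refl refl = refl
⟨⟩-+ (n ∷ ns) (k , u , u∈ , refl) (l , v , v∈ , refl) =
  k + l , u + v , ⟨⟩-+ ns u∈ v∈ , lemma k l n u v
  where
  lemma : ∀ k l n u v → k * n + u + (l * n + v) ≡ (k + l) * n + (u + v)
  lemma = solve-∀

⟨⟩-* : ∀ ns k {x} → x ∈ ⟨ ns ⟩ → k * x ∈ ⟨ ns ⟩
⟨⟩-* ns zero    x∈ = 0∈⟨ ns ⟩
⟨⟩-* ns (suc k) x∈ = ⟨⟩-+ ns x∈ (⟨⟩-* ns k x∈)

⟨⟩-∷ʳ⁺ : ∀ ns {n s} k → s ∈ ⟨ ns ⟩ → s + k * n ∈ ⟨ ns ∷ʳ n ⟩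
⟨⟩-∷ʳ⁺ []       {n} k refl = k , 0 , refl , +-comm 0 (k * n)
⟨⟩-∷ʳ⁺ (m ∷ ns) {n} k (l , y , y∈ , refl) =
  l , y + k * n , ⟨⟩-∷ʳ⁺ ns k y∈ , +-assoc (l * m) y (k * n)

⟨⟩-∷ʳ⁻ : ∀ ns {n x} → x ∈ ⟨ ns ∷ʳ n ⟩ → ∃[ s ] ∃[ k ] s ∈ ⟨ ns ⟩ × x ≡ s + k * n
⟨⟩-∷ʳ⁻ []       {n} (k , _ , refl , refl) = 0 , k , refl , +-comm (k * n) 0
⟨⟩-∷ʳ⁻ (m ∷ ns) {n} (l , y , y∈ , refl) with s , k , s∈ , refl ← ⟨⟩-∷ʳ⁻ ns y∈ =
  l * m + s , k , (l , s , s∈ , refl) , sym (+-assoc (l * m) s (k * n))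

-- As `n` is positive, `k * n ≤ x` forces `k ≤ x`, so a bounded search for the coefficient suffices.
-- Decidability makes least elements available constructively.
⟨⟩? : All NonZero ns → Decidable ⟨ ns ⟩
⟨⟩? []                       x = x ≟ 0
⟨⟩? {ns = n ∷ ns} (n≢0 ∷ ps) x =
  map′ (λ (k , _ , kn≤x , r∈) → k , x ∸ k * n , r∈ , sym (m+[n∸m]≡n kn≤x)) bound
       (anyUpTo? (λ k → (k * n ≤? x) ×-dec ⟨⟩? ps (x ∸ k * n)) (suc x))
  where
  bound : x ∈ ⟨ n ∷ ns ⟩ → ∃[ k ] k < suc x × k * n ≤ x × x ∸ k * n ∈ ⟨ ns ⟩
  bound (k , y , y∈ , refl) =
    k , s≤s (≤-trans (m≤m*n k n {{n≢0}}) (m≤m+n _ y)) , m≤m+n _ y ,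
    subst ⟨ ns ⟩ (sym (m+n∸m≡n (k * n) y)) y∈

gcds-∣ : ∀ ns {x} → x ∈ ⟨ ns ⟩ → gcds ns ∣ x
gcds-∣ []       refl = ∣-refl
gcds-∣ (n ∷ ns) (k , y , y∈ , refl) =
  ∣m∣n⇒∣m+n (∣n⇒∣m*n k (gcd[m,n]∣m n (gcds ns))) (∣-trans (gcd[m,n]∣n n (gcds ns)) (gcds-∣ ns y∈))

gcds-∷ʳ : ∀ ns n → gcds (ns ∷ʳ n) ≡ gcd (gcds ns) n
gcds-∷ʳ []       n = gcd-comm n 0
gcds-∷ʳ (m ∷ ns) n = trans (cong (gcd m) (gcds-∷ʳ ns n)) (sym (gcd-assoc m (gcds ns) n))

-- Bézout's identity without negative coefficients: the gcd is a difference of two elements of the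
-- submonoid. The negative term of the identity for `n` and `gcds ns` goes into the smaller element.
⟨⟩-Bézout : ∀ ns → ∃[ z ] z ∈ ⟨ ns ⟩ × z + gcds ns ∈ ⟨ ns ⟩
⟨⟩-Bézout []       = 0 , refl , refl
⟨⟩-Bézout (n ∷ ns) with ⟨⟩-Bézout ns | Bézout.identity (gcd-GCD n (gcds ns))
... | z , z∈ , z+g∈ | Bézout.+- x y eq =
  y * (z + gcds ns) , (0 , _ , ⟨⟩-* ns y z+g∈ , refl) ,
  (x , y * z , ⟨⟩-* ns y z∈ , trans (lemma y z (gcds ns) _) (cong (_+ y * z) eq))
  where
  lemma : ∀ y z g G → y * (z + g) + G ≡ G + y * g + y * z
  lemma = solve-∀
... | z , z∈ , z+g∈ | Bézout.-+ x y eq =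
  x * n + y * z , (x , _ , ⟨⟩-* ns y z∈ , refl) ,
  (0 , y * (z + gcds ns) , ⟨⟩-* ns y z+g∈ ,
   trans (lemma x n y z _) (trans (cong (_+ y * z) eq) (lemma′ y z (gcds ns))))
  where
  lemma : ∀ x n y z G → x * n + y * z + G ≡ G + x * n + y * z
  lemma = solve-∀
  lemma′ : ∀ y z g → y * g + y * z ≡ y * (z + g)
  lemma′ = solve-∀

-- Only the classes of the multiples of gcds ns modulo w meet ⟨ ns ⟩; Fin q indexes them.
module LeastInClass (pos : All NonZero ns) (q : ℕ) (w : ℕ) .{{_ : NonZero w}}
                    (w≡ : w ≡ q * gcds ns) where

  g : ℕ
  g = gcds ns

  InClass : Fin q → Pred ℕ 0ℓ
  InClass r a = a ∈ ⟨ ns ⟩ × a % w ≡ toℕ r * g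

  .g≢0 : NonZero g
  g≢0 = ≢-nonZero λ g≡0 → ≢-nonZero⁻¹ w (trans w≡ (trans (cong (q *_) g≡0) (*-zeroʳ q)))

  rg<w : ∀ (r : Fin q) → toℕ r * g < w
  rg<w r = subst (toℕ r * g <_) (sym w≡) (*-monoˡ-< g {{g≢0}} (toℕ<n r))

  inhabited : ∀ r → ∃ (InClass r)
  inhabited r with z , z∈ , z+g∈ ← ⟨⟩-Bézout ns = _ ,
    -- The second summand completes `k * z` to a multiple of `w`, leaving `k * g`.
    ⟨⟩-+ ns (⟨⟩-* ns k z+g∈) (⟨⟩-* ns (k * pred w) z∈) , (begin
      (k * (z + g) + k * pred w * z) % w         ≡⟨ cong (_% w) (lemma k z g (pred w)) ⟩
      (k * g + k * z * suc (pred w)) % w         ≡⟨ cong (λ v → (k * g + k * z * v) % w) (suc-pred w) ⟩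
      (k * g + k * z * w) % w                    ≡⟨ [m+kn]%n≡m%n (k * g) (k * z) w ⟩
      k * g % w                                  ≡⟨ m<n⇒m%n≡m (rg<w r) ⟩
      k * g                                      ∎)
    where
    open ≡-Reasoning
    k = toℕ r
    lemma : ∀ k z g v → k * (z + g) + k * v * z ≡ k * g + k * z * suc v
    lemma = solve-∀

  least : ∀ r → ∃ (IsMinimum (InClass r))
  least r = minimum (λ a → ⟨⟩? pos a ×-dec (a % w ≟ toℕ r * g)) (proj₂ (inhabited r))

  ℓ : Fin q → ℕ
  ℓ = proj₁ ∘ least

  ℓ-inClass : ∀ r → InClass r (ℓ r)
  ℓ-inClass = proj₁ ∘ proj₂ ∘ least

  ℓ-min : ∀ r b → InClass r b → ℓ r ≤ b
  ℓ-min = proj₂ ∘ proj₂ ∘ least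

  -- If `ℓ r ≡ b + w` with `b ∈ ⟨ ns ⟩`, then `b` is a smaller element of the same class.
  ℓ∈Ap : ∀ r → ℓ r ∈ Ap ⟨ ns ⟩ (+ w)
  ℓ∈Ap r = Ap⁺ (proj₁ (ℓ-inClass r)) λ {b} b∈ ℓ≡b+w →
    <⇒≱ (subst (b <_) (sym ℓ≡b+w) (m<m+n b (>-nonZero⁻¹ w)))
        (ℓ-min r b (b∈ , (begin
          b % w         ≡⟨ [m+n]%n≡m%n b w ⟨
          (b + w) % w   ≡⟨ cong (_% w) ℓ≡b+w ⟨
          ℓ r % w       ≡⟨ proj₂ (ℓ-inClass r) ⟩
          toℕ r * g     ∎)))
    where open ≡-Reasoning

  Ap-atLeast : AtLeast q (Ap ⟨ ns ⟩ (+ w))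
  Ap-atLeast = ℓ , inj , ℓ∈Ap
    where
    inj : Injective _≡_ _≡_ ℓ
    inj {r} {s} eq = toℕ-injective (*-cancelʳ-≡ (toℕ r) (toℕ s) g {{g≢0}} (begin
      toℕ r * g     ≡⟨ proj₂ (ℓ-inClass r) ⟨
      ℓ r % w       ≡⟨ cong (_% w) eq ⟩
      ℓ s % w       ≡⟨ proj₂ (ℓ-inClass s) ⟩
      toℕ s * g     ∎))
      where open ≡-Reasoning

open LeastInClass using (Ap-atLeast)

-- Write `a ≡ l + k * m`. For positive `k`, subtracting one `m` from `a` would leave an element of
-- `⟨ ns ⟩`.
Ap-unique : ∀ {m l a} .{{_ : NonZero m}} → m ∈ ⟨ ns ⟩ → l ∈ ⟨ ns ⟩ → a ∈ Ap ⟨ ns ⟩ (+ m) →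
            l % m ≡ a % m → l ≤ a → a ≡ l
Ap-unique {ns} {m} {l} {a} m∈ l∈ a∈Ap l≡a l≤a
  with k , l/m+k≡a/m ← m≤n⇒∃[o]m+o≡n (/-monoˡ-≤ m l≤a) = conclude k (begin
    a                              ≡⟨ m≡m%n+[m/n]*n a m ⟩
    a % m + a / m * m              ≡⟨ cong₂ (λ u v → u + v * m) l≡a l/m+k≡a/m ⟨
    l % m + (l / m + k) * m        ≡⟨ lemma (l % m) (l / m) k m ⟩
    l % m + l / m * m + k * m      ≡⟨ cong (_+ k * m) (m≡m%n+[m/n]*n l m) ⟨
    l + k * m                      ∎)
  where
  open ≡-Reasoning
  lemma : ∀ r q k m → r + (q + k) * m ≡ r + q * m + k * m
  lemma = solve-∀
  lemma′ : ∀ l k m → l + suc k * m ≡ l + k * m + m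
  lemma′ = solve-∀
  conclude : ∀ k → a ≡ l + k * m → a ≡ l
  conclude zero    a≡ = trans a≡ (+-identityʳ l)
  conclude (suc k) a≡ = ⊥-elim (Ap⁻ a∈Ap (⟨⟩-+ ns l∈ (⟨⟩-* ns k m∈)) (trans a≡ (lemma′ l k m)))

-- With gcd 1 every residue modulo `m` occurs, and by `Ap-unique` its least element is its only
-- Apéry element.
Ap-hasCardinality : All NonZero ns → gcds ns ≡ 1 →
                    ∀ m .{{_ : NonZero m}} → m ∈ ⟨ ns ⟩ → HasCardinality (Ap ⟨ ns ⟩ (+ m)) m
Ap-hasCardinality {ns} pos g≡1 m m∈ = surjective⇒hasCardinality (Ap-atLeast pos m m m≡) surj
  where
  m≡ : m ≡ m * gcds ns
  m≡ = trans (sym (*-identityʳ m)) (cong (m *_) (sym g≡1))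
  open LeastInClass pos m m m≡ using (ℓ; ℓ-inClass; ℓ-min)

  surj : ∀ {a} → a ∈ Ap ⟨ ns ⟩ (+ m) → ∃[ r ] a ≡ ℓ r
  surj {a} a∈Ap = r , Ap-unique m∈ (proj₁ (ℓ-inClass r)) a∈Ap
                        (trans (proj₂ (ℓ-inClass r)) (sym a%m≡)) (ℓ-min r a (proj₁ a∈Ap , a%m≡))
    where
    r = fromℕ< (m%n<n a m)
    a%m≡ : a % m ≡ toℕ r * gcds ns
    a%m≡ = begin
      a % m              ≡⟨ toℕ-fromℕ< (m%n<n a m) ⟨
      toℕ r              ≡⟨ *-identityʳ (toℕ r) ⟨
      toℕ r * 1          ≡⟨ cong (toℕ r *_) g≡1 ⟨
      toℕ r * gcds ns    ∎
      where open ≡-Reasoning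

-- Adjoining one generator

-- Coprimality makes `e` the gcd of `gcds ns` and `n`; the quotients `c` and `n′` are given by
-- equations rather than by division.
module Adjoin {ns : List ℕ} (n c n′ e : ℕ) .{{_ : NonZero c}} .{{_ : NonZero e}}
              (D≡c*e : gcds ns ≡ c * e) (n≡n′*e : n ≡ n′ * e)
              (coprime : Coprime c n′) (cn∈ : c * n ∈ ⟨ ns ⟩) where

  D : ℕ
  D = gcds ns

  D∣kn⇒c∣k : ∀ k → D ∣ k * n → c ∣ k
  D∣kn⇒c∣k k D∣kn =
    coprime-divisor coprime (*-cancelʳ-∣ e (subst₂ _∣_ D≡c*e (trans (cong (k *_) n≡n′*e) (lemma k n′ e)) D∣kn))
    where
    lemma : ∀ k n′ e → k * (n′ * e) ≡ n′ * k * e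
    lemma = solve-∀

  -- Subtraction gives `D ∣ (j ∸ i) * n`, hence `c ∣ j ∸ i`, and `j ∸ i` is below `c`.
  digit-unique : ∀ {u v i j} → D ∣ u → D ∣ v → i ≤ j → j < c → u + i * n ≡ v + j * n → i ≡ j
  digit-unique {u} {v} {i} D∣u D∣v i≤j j<c eq with t , refl ← m≤n⇒∃[o]m+o≡n i≤j =
    sym (trans (cong (λ k → i + k) t≡0) (+-identityʳ i))
    where
    lemma : ∀ v i t n → v + (i + t) * n ≡ v + t * n + i * n
    lemma = solve-∀
    u≡v+tn : u ≡ v + t * n
    u≡v+tn = +-cancelʳ-≡ (i * n) u (v + t * n) (trans eq (lemma v i t n))
    c∣t : c ∣ t
    c∣t = D∣kn⇒c∣k t (∣m+n∣m⇒∣n (subst (D ∣_) u≡v+tn D∣u) D∣v)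
    t≡0 : t ≡ 0
    t≡0 = trans (sym (m<n⇒m%n≡m (≤-<-trans (m≤n+m t i) j<c))) (n∣m⇒m%n≡0 t c c∣t)

  -- Only divisibility by `D` is asked of `u` and `v`, because one of them will be
  -- `t + (x + r * n)`, which need not lie in `⟨ ns ⟩`.
  unique : ∀ {u v i j} → D ∣ u → D ∣ v → i < c → j < c → u + i * n ≡ v + j * n → u ≡ v × i ≡ j
  unique {u} {v} {i} {j} D∣u D∣v i<c j<c eq = cancel (digits (≤-total i j))
    where
    digits : i ≤ j ⊎ j ≤ i → i ≡ j
    digits (inj₁ i≤j) = digit-unique D∣u D∣v i≤j j<c eq
    digits (inj₂ j≤i) = sym (digit-unique D∣v D∣u j≤i i<c (sym eq))
    cancel : i ≡ j → u ≡ v × i ≡ j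
    cancel refl = +-cancelʳ-≡ (i * n) u v eq , refl

  -- Divide the coefficient of `n` by `c`: multiples of `c * n` are absorbed into `⟨ ns ⟩`. This is
  -- where freeness enters.
  expansion : ∀ {b} → b ∈ ⟨ ns ∷ʳ n ⟩ → ∃[ s ] ∃[ j ] s ∈ ⟨ ns ⟩ × j < c × b ≡ s + j * n
  expansion b∈ with s , k , s∈ , refl ← ⟨⟩-∷ʳ⁻ ns b∈ =
    s + k / c * (c * n) , k % c , ⟨⟩-+ ns s∈ (⟨⟩-* ns (k / c) cn∈) , m%n<n k c ,
    trans (cong (λ k → s + k * n) (m≡m%n+[m/n]*n k c)) (lemma s (k % c) (k / c) c n)
    where
    lemma : ∀ s r q c n → s + (r + q * c) * n ≡ s + q * (c * n) + r * n
    lemma = solve-∀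

  -- Suppose `s + i * n ≡ b + x` and expand `b` as `t + j * n`. Adding `r * n` to both sides turns
  -- `x` into a multiple of `D`, and `i + r` is still below `c`, so uniqueness yields
  -- `s ≡ t + (x + r * n)`, against the choice of `s`.
  Ap-∷ʳ-atLeast : ∀ x {q r} → r ≤ c → D ∣ x + r * n →
                  AtLeast q (Ap ⟨ ns ⟩ (+ (x + r * n))) → AtLeast ((c ∸ r) * q) (Ap ⟨ ns ∷ʳ n ⟩ (+ x))
  Ap-∷ʳ-atLeast x {q} {r} r≤c D∣w atLeast = atLeast-× {Q = Ap ⟨ ns ∷ʳ n ⟩ (+ x)} atLeast (λ s j → s + j * n)
    (λ a∈ b∈ i< j< → unique (gcds-∣ ns (proj₁ a∈)) (gcds-∣ ns (proj₁ b∈)) (below i<) (below j<))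
    (λ {s} {i} s∈Ap i< → Ap⁺ (⟨⟩-∷ʳ⁺ ns i (proj₁ s∈Ap)) (outside s∈Ap i<))
    where
    below : ∀ {i} → i < c ∸ r → i < c
    below i< = <-≤-trans i< (m∸n≤m c r)
    lemma : ∀ s i r n → s + (i + r) * n ≡ s + i * n + r * n
    lemma = solve-∀
    lemma′ : ∀ t j n x r → t + j * n + x + r * n ≡ t + (x + r * n) + j * n
    lemma′ = solve-∀
    outside : ∀ {s i b} → s ∈ Ap ⟨ ns ⟩ (+ (x + r * n)) → i < c ∸ r → b ∈ ⟨ ns ∷ʳ n ⟩ → s + i * n ≢ b + x
    outside {s} {i} s∈Ap i< b∈ eq with t , j , t∈ , j<c , refl ← expansion b∈ =
      Ap⁻ s∈Ap t∈ (proj₁ (unique (gcds-∣ ns (proj₁ s∈Ap)) (∣m∣n⇒∣m+n (gcds-∣ ns t∈) D∣w) i+r<c j<c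
        (trans (lemma s i r n) (trans (cong (_+ r * n) eq) (lemma′ t j n x r)))))
      where
      i+r<c : i + r < c
      i+r<c = m≤o∸n⇒m+n≤o (suc i) r≤c i<

  solvable : ∀ x → ∃[ r ] c ∣ x + r * n′
  solvable x with coprime-Bézout coprime
  -- Here `b * n′` is -1 modulo `c`.
  ... | Bézout.+- a b eq = x * b , divides (x * a) (trans (lemma x b n′) (trans (cong (x *_) eq) (sym (*-assoc x a c))))
    where
    lemma : ∀ x b n → x + x * b * n ≡ x * (1 + b * n)
    lemma = solve-∀
  -- Here `b * n′` is 1 modulo `c`, and `pred c` plays the part of -1.
  ... | Bézout.-+ a b eq = pred c * x * b , divides (x + pred c * x * a) (begin
      x + pred c * x * b * n′              ≡⟨ lemma₁ x (pred c) b n′ ⟩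
      x + pred c * x * (b * n′)            ≡⟨ cong (λ k → x + pred c * x * k) eq ⟨
      x + pred c * x * (1 + a * c)         ≡⟨ lemma₂ x (pred c) a c ⟩
      x * suc (pred c) + pred c * x * a * c ≡⟨ cong (λ k → x * k + pred c * x * a * c) (suc-pred c) ⟩
      x * c + pred c * x * a * c           ≡⟨ *-distribʳ-+ c x (pred c * x * a) ⟨
      (x + pred c * x * a) * c             ∎)
    where
    open ≡-Reasoning
    lemma₁ : ∀ x p b n → x + p * x * b * n ≡ x + p * x * (b * n)
    lemma₁ = solve-∀
    lemma₂ : ∀ x p a c → x + p * x * (1 + a * c) ≡ x * suc p + p * x * a * c
    lemma₂ = solve-∀

  residue : ∀ {x} → e ∣ x → ∃[ r ] r < c × D ∣ x + r * n
  residue (divides-refl x′) with k , c∣x′+kn′ ← solvable x′ = k % c , m%n<n k c ,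
    subst₂ _∣_ (sym D≡c*e) (trans (lemma′ x′ (k % c) n′ e) (cong (λ n → x′ * e + k % c * n) (sym n≡n′*e)))
      (*-monoˡ-∣ e (∣m+n∣m⇒∣n (subst (c ∣_) split c∣x′+kn′) (∣m⇒∣m*n n′ (n∣m*n (k / c)))))
    where
    lemma : ∀ x r q c n → x + (r + q * c) * n ≡ q * c * n + (x + r * n)
    lemma = solve-∀
    lemma′ : ∀ x r n e → (x + r * n) * e ≡ x * e + r * (n * e)
    lemma′ = solve-∀
    split : x′ + k * n′ ≡ k / c * c * n′ + (x′ + k % c * n′)
    split = trans (cong (λ k → x′ + k * n′) (m≡m%n+[m/n]*n k c)) (lemma x′ (k % c) (k / c) c n′)

-- The lower bound under adjunction of a generator

ApBound : ℕ → List ℕ → Set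
ApBound M ns = ∀ {x} → 0 < x → gcds ns ∣ x → ∃[ q ] AtLeast q (Ap ⟨ ns ⟩ (+ x)) × M ≤ q * gcds ns

apBound-gcds : ∀ {M} → All NonZero ns → M ≤ gcds ns → ApBound M ns
apBound-gcds {ns} pos M≤D {x} 0<x (divides q x≡q*D) =
  q , Ap-atLeast pos q x x≡q*D , ≤-trans M≤D (≤-trans (∣⇒≤ (divides q x≡q*D)) (≤-reflexive x≡q*D))
  where instance _ = >-nonZero 0<x

-- For positive `r` and `j`, (r - 1)(j - 1) ≥ 0 gives r j ≥ r + j - 1; the positive term `j * x`
-- makes the inequality strict.
[r+j∸1]*n<j*[x+r*n] : ∀ r j x n → 0 < r → 0 < j → 0 < x → (r + j ∸ 1) * n < j * (x + r * n)
[r+j∸1]*n<j*[x+r*n] (suc a) (suc b) (suc x) n _ _ _ =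
  subst ((a + suc b) * n <_) (sym (lemma a b x n)) (s≤s (m≤m+n _ _))
  where
  lemma : ∀ a b x n → suc b * (suc x + suc a * n) ≡ suc ((a + suc b) * n + (x + b * suc x + a * b * n))
  lemma = solve-∀

-- The hypothesis `large` isolates the arithmetic in which the second generator differs from the
-- later ones. It is applied with `k` equal to `(c ∸ r) * q`.
module _ (pos : All NonZero ns) (n c n′ e M : ℕ) .{{_ : NonZero c}} .{{_ : NonZero e}}
         (D≡c*e : gcds ns ≡ c * e) (e≡ : gcds (ns ∷ʳ n) ≡ e) (n≡n′*e : n ≡ n′ * e)
         (coprime : Coprime c n′) (cn∈ : c * n ∈ ⟨ ns ⟩)
         (large : ∀ k → (c ∸ 1) * n′ < c * k → M ≤ k * e) where

  open Adjoin n c n′ e D≡c*e n≡n′*e coprime cn∈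

  apBound-∷ʳ : ApBound M ns → ApBound M (ns ∷ʳ n)
  apBound-∷ʳ bound {x} 0<x e∣x with residue (subst (_∣ x) e≡ e∣x)
  ... | zero , _ , D∣w with q , atLeast , M≤qD ← bound (m≤n⇒m≤n+o 0 0<x) D∣w =
    c * q , Ap-∷ʳ-atLeast x z≤n D∣w atLeast , (begin
      M                          ≤⟨ M≤qD ⟩
      q * gcds ns                ≡⟨ cong (q *_) D≡c*e ⟩
      q * (c * e)                ≡⟨ lemma q c e ⟩
      c * q * e                  ≡⟨ cong (c * q *_) e≡ ⟨
      c * q * gcds (ns ∷ʳ n)     ∎)
    where
    open ≤-Reasoning
    lemma : ∀ q c e → q * (c * e) ≡ c * q * e
    lemma = solve-∀
  ... | r@(suc _) , r<c , D∣w@(divides q w≡q*D) =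
    (c ∸ r) * q ,
    Ap-∷ʳ-atLeast x (<⇒≤ r<c) D∣w (Ap-atLeast pos q (x + r * n) {{w≢0}} w≡q*D) ,
    subst (λ e → M ≤ (c ∸ r) * q * e) (sym e≡) (large _ (*-cancelʳ-< e _ _ (begin-strict
      (c ∸ 1) * n′ * e              ≡⟨ *-assoc (c ∸ 1) n′ e ⟩
      (c ∸ 1) * (n′ * e)            ≡⟨ cong ((c ∸ 1) *_) n≡n′*e ⟨
      (c ∸ 1) * n                   ≡⟨ cong (λ c → (c ∸ 1) * n) (m+[n∸m]≡n (<⇒≤ r<c)) ⟨
      (r + j ∸ 1) * n               <⟨ [r+j∸1]*n<j*[x+r*n] r j x n z<s (m<n⇒0<n∸m r<c) 0<x ⟩
      j * (x + r * n)               ≡⟨ cong (j *_) (trans w≡q*D (cong (q *_) D≡c*e)) ⟩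
      j * (q * (c * e))             ≡⟨ lemma j q c e ⟩
      c * (j * q) * e               ∎)))
    where
    open ≤-Reasoning
    j = c ∸ r
    w≢0 : NonZero (x + r * n)
    w≢0 = >-nonZero (m≤n⇒m≤n+o (r * n) 0<x)
    lemma : ∀ j q c e → j * (q * (c * e)) ≡ c * (j * q) * e
    lemma = solve-∀

-- If `k` were below both `c` and `n′`, then `c * k ≤ (c ∸ 1) * suc k ≤ (c ∸ 1) * n′`, against the
-- gap. In the application `c * e` is n₁ and `n′ * e` is n₂.
large-second : ∀ c n′ e {M} → M ≤ c * e → M ≤ n′ * e → ∀ k → (c ∸ 1) * n′ < c * k → M ≤ k * e
large-second c n′ e M≤ce M≤n′e k gap with k <? c | k <? n′
... | no k≮c  | _        = ≤-trans M≤ce (*-monoˡ-≤ e (≮⇒≥ k≮c))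
... | yes _   | no k≮n′  = ≤-trans M≤n′e (*-monoˡ-≤ e (≮⇒≥ k≮n′))
... | yes k<c | yes k<n′ = ⊥-elim (<⇒≱ gap (≤-trans (step k<c) (*-monoʳ-≤ (c ∸ 1) k<n′)))
  where
  step : ∀ {c} → k < c → c * k ≤ (c ∸ 1) * suc k
  step {suc c} (s≤s k≤c) = ≤-trans (+-monoˡ-≤ (c * k) k≤c) (≤-reflexive (sym (*-suc c k)))

large-later : ∀ c n′ e {M} .{{_ : NonZero c}} → c * M ≤ (c ∸ 1) * (n′ * e) →
              ∀ k → (c ∸ 1) * n′ < c * k → M ≤ k * e
large-later c n′ e {M} slope k gap = *-cancelˡ-≤ c (begin
  c * M                  ≤⟨ slope ⟩
  (c ∸ 1) * (n′ * e)     ≡⟨ *-assoc (c ∸ 1) n′ e ⟨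
  (c ∸ 1) * n′ * e       ≤⟨ *-monoˡ-≤ e (<⇒≤ gap) ⟩
  c * k * e              ≡⟨ *-assoc c k e ⟩
  c * (k * e)            ∎)
  where open ≤-Reasoning

coprime-quotients : ∀ c n′ e .{{_ : NonZero e}} → gcd (c * e) (n′ * e) ≡ e → Coprime c n′
coprime-quotients c n′ e gcd≡e = gcd≡1⇒coprime (*-cancelˡ-≡ _ 1 e (begin
  e * gcd c n′             ≡⟨ c*gcd[m,n]≡gcd[cm,cn] e c n′ ⟩
  gcd (e * c) (e * n′)     ≡⟨ cong₂ gcd (*-comm e c) (*-comm e n′) ⟩
  gcd (c * e) (n′ * e)     ≡⟨ gcd≡e ⟩
  e                        ≡⟨ *-identityʳ e ⟨
  e * 1                    ∎))
  where open ≡-Reasoning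

-- Induction along the arrangement

lookup∈⟨⟩ : ∀ ns i → lookup ns i ∈ ⟨ ns ⟩
lookup∈⟨⟩ (n ∷ ns) zero    = 1 , 0 , 0∈⟨ ns ⟩ , sym (trans (+-identityʳ (1 * n)) (*-identityˡ n))
lookup∈⟨⟩ (n ∷ ns) (suc i) = 0 , _ , lookup∈⟨⟩ ns i , refl

-- `gcds ms` is a difference of two elements of the common submonoid, both divisible by `gcds ns`.
gcds≡1-resp-≐ : ∀ {ms} → gcds ms ≡ 1 → ⟨ ms ⟩ ≐ ⟨ ns ⟩ → gcds ns ≡ 1
gcds≡1-resp-≐ {ns} {ms} g≡1 (ms⊆ns , _) with z , z∈ , z+g∈ ← ⟨⟩-Bézout ms =
  ∣1⇒≡1 (subst (gcds ns ∣_) g≡1 (∣m+n∣m⇒∣n (gcds-∣ ns (ms⊆ns z+g∈)) (gcds-∣ ns (ms⊆ns z∈))))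

module _ (Γ : Pred ℕ 0ℓ) (n₁ : ℕ) (ns : List ℕ) (free : IsFree Γ (n₁ ∷ ns)) where

  open IsFree free

  L : List ℕ
  L = n₁ ∷ ns

  lookup-positive : ∀ i → 0 < lookup L i
  lookup-positive i = >-nonZero⁻¹ _ {{All.lookup positive (∈-lookup i)}}

  lookup∈Γ : ∀ i → lookup L i ∈ Γ
  lookup∈Γ i = proj₂ generates (lookup∈⟨⟩ L i)

  multiplicity : ∃ (IsMultiplicity Γ)
  multiplicity =
    minimum (λ x → (0 <? x) ×-dec map′ (proj₂ generates) (proj₁ generates) (⟨⟩? positive x))
            (lookup-positive zero , lookup∈Γ zero)

  apBound-prefix : ∀ {M} → (∀ i → M ≤ lookup L i) →
    (∀ i → 2 ≤ toℕ i → (c L positive i ∸ 1) * lookup L i ≥ c L positive i * n₁) →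
    ∀ i → ApBound M (take (suc (toℕ i)) L)
  apBound-prefix {M} M≤ slope = <-weakInduction _ first next
    where
    first : ApBound M (n₁ ∷ [])
    first = apBound-gcds (All.take⁺ 1 positive) (subst (M ≤_) (sym (gcd-identityʳ n₁)) (M≤ zero))

    next : ∀ i → ApBound M (take (suc (toℕ (inject₁ i))) L) → ApBound M (take (suc (toℕ (suc i))) L)
    next i bound = subst (ApBound M) (sym prefix≡)
      (apBound-∷ʳ (All.take⁺ (toℕ j) positive) n cⱼ (quotient e∣n) e M {{c≢0}} {{e≢0}}
        (sym ce≡D) (cong gcds (sym prefix≡)) (_∣_.equality e∣n)
        (coprime-quotients cⱼ (quotient e∣n) e {{e≢0}}
          (trans (cong₂ gcd ce≡D (sym (_∣_.equality e∣n))) (sym e≡gcd)))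
        (c*n∈prefix j (s≤s z≤n)) (large (toℕ i) refl)
        (subst (λ k → ApBound M (take (suc k) L)) (toℕ-inject₁ i) bound))
      where
      j = suc i
      n = lookup L j
      e = d L (suc (toℕ j))
      e≢0 = d-nonZero positive j
      cⱼ = c L positive j
      prefix≡ : take (suc (toℕ j)) L ≡ take (toℕ j) L ∷ʳ n
      prefix≡ = take-suc L j
      e≡gcd : e ≡ gcd (d L (toℕ j)) n
      e≡gcd = trans (cong gcds prefix≡) (gcds-∷ʳ (take (toℕ j) L) n)
      e∣n : e ∣ n
      e∣n = subst (_∣ n) (sym e≡gcd) (gcd[m,n]∣n (d L (toℕ j)) n)
      ce≡D : cⱼ * e ≡ d L (toℕ j)
      ce≡D = m/n*n≡m {{e≢0}} (subst (_∣ d L (toℕ j)) (sym e≡gcd) (gcd[m,n]∣m (d L (toℕ j)) n))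
      c≢0 : NonZero cⱼ
      c≢0 = ≢-nonZero λ c≡0 → ≢-nonZero⁻¹ _ {{d-nonZero positive (inject₁ i)}}
        (trans (cong (d L ∘ suc) (toℕ-inject₁ i)) (trans (sym ce≡D) (cong (_* e) c≡0)))
      -- The new generator sits at position `suc i`, so `toℕ i ≡ 0` is the case of n₂, and `slope`
      -- covers exactly the other cases.
      large : ∀ m → toℕ i ≡ m → ∀ k → (cⱼ ∸ 1) * quotient e∣n < cⱼ * k → M ≤ k * e
      large zero i≡0 = large-second cⱼ (quotient e∣n) e
        (subst (M ≤_) (trans (sym D≡n₁) (sym ce≡D)) (M≤ zero))
        (subst (M ≤_) (_∣_.equality e∣n) (M≤ j))
        where
        D≡n₁ : d L (toℕ j) ≡ n₁
        D≡n₁ = trans (cong (d L ∘ suc) i≡0) (gcd-identityʳ n₁)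
      large (suc m) i≡1+m = large-later cⱼ (quotient e∣n) e {{c≢0}}
        (≤-trans (*-monoʳ-≤ cⱼ (M≤ zero))
          (subst (λ n → cⱼ * n₁ ≤ (cⱼ ∸ 1) * n) (_∣_.equality e∣n) (slope j (s≤s 1≤i))))
        where
        1≤i : 1 ≤ toℕ i
        1≤i = subst (1 ≤_) (sym i≡1+m) (s≤s z≤n)

  -- The value `M` is attained at `x = M`. Since the full gcd is 1, the bound for the whole
  -- arrangement applies to every positive `x`.
  multiplicity⇒E₂ : gcds L ≡ 1 →
    (∀ i → 2 ≤ toℕ i → (c L positive i ∸ 1) * lookup L i ≥ c L positive i * n₁) →
    ∀ {M} → IsMultiplicity Γ M → IsE₂ Γ M
  multiplicity⇒E₂ gcds≡1 slope {M} ((0<M , M∈Γ) , M-min) = (M , 0<M , card) , minimal′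
    where
    card : HasCardinality (Ap Γ (+ M)) M
    card = hasCardinality-resp-≐ (Ap-resp-≐ (+ M) (≐-sym generates))
      (Ap-hasCardinality positive gcds≡1 M {{>-nonZero 0<M}} (proj₁ generates M∈Γ))

    bound : ApBound M L
    -- At the last position, `fromℕ (length ns)`, the prefix is all of `L`.
    bound = subst (ApBound M) (take-all _ L (≤-reflexive (cong suc (sym (toℕ-fromℕ (length ns))))))
      (apBound-prefix (λ i → M-min _ (lookup-positive i , lookup∈Γ i)) slope (fromℕ (length ns)))

    minimal′ : ∀ k → ∃[ x ] 0 < x × HasCardinality (Ap Γ (+ x)) k → M ≤ k
    minimal′ k (x , 0<x , card) =
      let q , atLeast , M≤q*D = bound 0<x (subst (_∣ x) (sym gcds≡1) (1∣ x))
      in ≤-trans (subst (M ≤_) (trans (cong (q *_) gcds≡1) (*-identityʳ q)) M≤q*D)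
           (atLeast⇒≤ atLeast (hasCardinality-resp-≐ (Ap-resp-≐ (+ x) generates) card))

theorem20 : (Γ : Pred ℕ 0ℓ) → IsNumericalSemigroup Γ →
    (n₁ : ℕ) (ns : List ℕ) (free : IsFree Γ (n₁ ∷ ns)) →
    (let cᵢ = c (n₁ ∷ ns) (IsFree.positive free)) →
    -- (cᵢ − 1) / cᵢ · nᵢ ≥ n₁, multiplied by cᵢ (which is positive by freeness)
    (∀ (i : Fin (length (n₁ ∷ ns))) → 2 ≤ toℕ i →
      (cᵢ i ∸ 1) * lookup (n₁ ∷ ns) i ≥ cᵢ i * n₁) →
    ∃[ k ] (IsE₂ Γ k × IsMultiplicity Γ k)
theorem20 Γ numerical n₁ ns free slope =
  map₂ (λ M-mult → multiplicity⇒E₂ Γ n₁ ns free gcds≡1 slope M-mult , M-mult)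
       (multiplicity Γ n₁ ns free)
  where
  gcds≡1 : gcds (n₁ ∷ ns) ≡ 1
  gcds≡1 = gcds≡1-resp-≐ (IsNumericalSemigroup.coprime numerical)
    (≐-trans (≐-sym (IsNumericalSemigroup.generates numerical)) (IsFree.generates free))
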